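{- Let $\mathcal{M}'_1=(\mathcal{N}',\mathcal{I}'_1,w)$ and $\mathcal{M}'_2=(\mathcal{N}',\mathcal{I}'_2,w)$ be weighted matroids with $w(e)\in\{1,2,\dots,W\}$ for all $e\in\mathcal{N}'$, and let $\mathrm{OPT}'$ be the maximum weight of a common independent set of $\mathcal{M}'_1,\mathcal{M}'_2$. Let $\mathcal{M}_1=(\mathcal{N},\mathcal{I}_1)$, $\mathcal{M}_2=(\mathcal{N},\mathcal{I}_2)$ be the unfolded instance and $\mathrm{OPT}$ the maximum cardinality of a common independent set of $\mathcal{M}_1,\mathcal{M}_2$. Then $\mathrm{OPT}=\mathrm{OPT}'$.
   Context: Unfolding: the ground set $\mathcal{N}$ consists of copies $e_1,\dots,e_{w(e)}$ for each $e\in\mathcal{N}'$. For $I\subseteq\mathcal{N}$ and $i\in[W]$ let $I'_{1,i}=\{e: e_i\in I\}$ and $I'_{2,i}=\{e: e_{w(e)-i+1}\in I\}$. Then $I\in\mathcal{I}_1$ iff $I'_{1,i}\in\mathcal{I}'_1$ for all $i\in[W]$, and $I\in\mathcal{I}_2$ iff $I'_{2,i}\in\mathcal{I}'_2$ for all $i\in[W]$. A common independent set is a set independent in both matroids; its weight is the sum of element weights. -}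

module Defs where

open import Data.Nat using (ℕ; zero; suc; _+_; _∸_; _<_; _≤_; _<ᵇ_)
open import Data.Bool using (Bool; true; false; if_then_else_)
open import Data.Vec using (Vec; []; _∷_; tabulate; lookup)
open import Data.Fin using (Fin; toℕ) renaming (zero to fzero; suc to fsuc)
open import Relation.Binary.PropositionalEquality using (_≡_)
open import Data.Fin.Subset using (Subset; ⊥; _⊆_; _∈_; _∉_; ∣_∣; _∪_; ⁅_⁆)
open import Data.Product using (Σ; _×_; _,_; ∃-syntax)

record Matroid (n : ℕ) : Set₁ where
  field
    Indep       : Subset n → Set
    indep-empty : Indep ⊥
    hereditary  : ∀ {A B : Subset n} → A ⊆ B → Indep B → Indep A
    exchange    : ∀ {A B : Subset n} → Indep A → Indep B → ∣ A ∣ < ∣ B ∣ →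
                  ∃[ x ] (x ∈ B × x ∉ A × Indep (⁅ x ⁆ ∪ A))
open Matroid public

weight : ∀ {n} → (Fin n → ℕ) → Subset n → ℕ
weight {zero}  w []            = 0
weight {suc n} w (true  ∷ S)   = w fzero + weight (λ e → w (fsuc e)) S
weight {suc n} w (false ∷ S)   = weight (λ e → w (fsuc e)) S

CommonIndep : ∀ {n} → Matroid n → Matroid n → Subset n → Set
CommonIndep M₁ M₂ S = Indep M₁ S × Indep M₂ S

IsMaxCommonWeight : ∀ {n} → Matroid n → Matroid n → (Fin n → ℕ) → ℕ → Set
IsMaxCommonWeight M₁ M₂ w v =
  (∃[ S ] (CommonIndep M₁ M₂ S × weight w S ≡ v)) ×
  (∀ S → CommonIndep M₁ M₂ S → weight w S ≤ v)

-- Unfolded ground set  N = { e_j : e ∈ Fin n, j ∈ [w(e)] }.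
-- A subset of N is given by, for each e, a subset of the copies Fin (w e);
-- the copy e_j (1-based j) corresponds to index j-1 in Fin (w e).
UnfSubset : ∀ {n} → (Fin n → ℕ) → Set
UnfSubset {n} w = (e : Fin n) → Subset (w e)

card : ∀ {n} {w : Fin n → ℕ} → UnfSubset w → ℕ
card {zero}  I = 0
card {suc n} I = ∣ I fzero ∣ + card (λ e → I (fsuc e))

bit : ∀ {m} → Subset m → ℕ → Bool
bit []      k       = false
bit (b ∷ v) zero    = b
bit (b ∷ v) (suc k) = bit v k

-- For i ∈ Fin W (representing the 1-based index i+1):
-- I'_{1,i} = { e : e_i ∈ I }
proj₁I : ∀ {n W} (w : Fin n → ℕ) → UnfSubset w → Fin W → Subset n
proj₁I w I i = tabulate (λ e → bit (I e) (toℕ i))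

-- I'_{2,i} = { e : e_{w(e)-i+1} ∈ I }   (only when i ≤ w(e))
proj₂I : ∀ {n W} (w : Fin n → ℕ) → UnfSubset w → Fin W → Subset n
proj₂I w I i = tabulate (λ e → if toℕ i <ᵇ w e then bit (I e) (w e ∸ suc (toℕ i)) else false)

UnfIndep₁ : ∀ {n} (W : ℕ) (M : Matroid n) (w : Fin n → ℕ) → UnfSubset w → Set
UnfIndep₁ W M w I = (i : Fin W) → Indep M (proj₁I w I i)

UnfIndep₂ : ∀ {n} (W : ℕ) (M : Matroid n) (w : Fin n → ℕ) → UnfSubset w → Set
UnfIndep₂ W M w I = (i : Fin W) → Indep M (proj₂I w I i)

IsMaxUnfoldedCard : ∀ {n} (W : ℕ) → Matroid n → Matroid n → (Fin n → ℕ) → ℕ → Set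
IsMaxUnfoldedCard W M₁ M₂ w v =
  (∃[ I ] ((UnfIndep₁ W M₁ w I × UnfIndep₂ W M₂ w I) × card I ≡ v)) ×
  (∀ I → UnfIndep₁ W M₁ w I → UnfIndep₂ W M₂ w I → card I ≤ v)

{-# OPTIONS --safe #-}
module Submission where

-- A common independent set S unfolds to the set of all its copies, so OPT' ≤ OPT.
-- Conversely, let L(u) = ∑ᵢ rank {u > i} be the Lovász extension of a rank function.
-- If w ≤ u₁ + u₂, then every copy e_j has j ≤ u₁(e) or w(e) - j + 1 ≤ u₂(e), so a common
-- independent set of the unfolded matroids has at most L₁(u₁) + L₂(u₂) elements.
-- It remains to find a common independent S and a cover (u₁ , u₂) of w with
-- L₁(u₁) + L₂(u₂) ≤ w(S) (weight splitting).  This goes by induction on the ground set: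
-- deleting an element e gives a cover of value x = w(S₀) that covers e zero times, and
-- contracting it gives one of value y + 2t, y = w(S₁), that covers e 2t times for a large t.
-- Since L is submodular under p , q ↦ (p - α) ∨ q , p ∧ (q + α), two covers of e with
-- multiplicities s and r can be uncrossed into covers with multiplicities s + 1 and r - 1
-- without increasing the total value.  As values are integers, either the first one keeps
-- value ≤ x or the second one keeps value ≤ y + multiplicity; iterating, one reaches
-- multiplicity w(e) with value at most w(S₀) or w(S₁ ∪ {e}).

open import Defs
open import Data.Bool using (Bool; true; false; _∧_; if_then_else_)
open import Data.Bool.Properties using (T-≡)
open import Data.Fin using (Fin; toℕ; fromℕ<) renaming (zero to fzero; suc to fsuc)
open import Data.Fin.Properties using (toℕ-fromℕ<)
open import Data.Fin.Subset using (Subset; ⊥; ⊤; _⊆_; _∈_; ∣_∣; _∪_; _∩_; ⁅_⁆)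
open import Data.Fin.Subset.Properties
open import Data.Nat using (ℕ; zero; suc; _+_; _∸_; _⊔_; _⊓_; _≤_; _<_; _<ᵇ_; z≤n; s≤s; s≤s⁻¹)
open import Data.Nat.Properties
open import Data.Product using (_×_; _,_; proj₁; proj₂; ∃-syntax)
open import Data.Sum using (_⊎_; inj₁; inj₂; [_,_]′)
open import Data.Vec using ([]; _∷_; here; there; lookup; tabulate)
open import Data.Vec.Functional using () renaming (_∷_ to _◂_)
open import Data.Vec.Properties using (lookup∘tabulate; []=⇒lookup; lookup⇒[]=)
open import Algebra.Properties.CommutativeSemigroup +-commutativeSemigroup using (interchange; x∙yz≈y∙xz)
open import Function using (_∘_; id; Equivalence)
open import Relation.Binary.PropositionalEquality using (_≡_; refl; sym; trans; cong; cong₂; subst; subst₂)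
open import Relation.Nullary using (¬_; yes; no; contradiction; decidable-stable; ¬¬-excluded-middle; _×-dec_)
open import Relation.Unary using (Decidable)

private variable
  m n : ℕ

-- Finite sums

∑< : ℕ → (ℕ → ℕ) → ℕ
∑< zero    g = 0
∑< (suc k) g = g 0 + ∑< k (g ∘ suc)

∑<-mono : ∀ k {g h} → (∀ i → i < k → g i ≤ h i) → ∑< k g ≤ ∑< k h
∑<-mono zero    g≤h = z≤n
∑<-mono (suc k) g≤h = +-mono-≤ (g≤h 0 (s≤s z≤n)) (∑<-mono k λ i i<k → g≤h (suc i) (s≤s i<k))

∑<-monoˡ : ∀ {j k} g → j ≤ k → ∑< j g ≤ ∑< k g
∑<-monoˡ g z≤n       = z≤n
∑<-monoˡ g (s≤s j≤k) = +-monoʳ-≤ (g 0) (∑<-monoˡ (g ∘ suc) j≤k)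

∑<-+ : ∀ k g h → ∑< k (λ i → g i + h i) ≡ ∑< k g + ∑< k h
∑<-+ zero    g h = refl
∑<-+ (suc k) g h = trans (cong (g 0 + h 0 +_) (∑<-+ k (g ∘ suc) (h ∘ suc)))
                         (interchange (g 0) (h 0) _ _)

∑<-split : ∀ j k g → ∑< (j + k) g ≡ ∑< j g + ∑< k (λ i → g (j + i))
∑<-split zero    k g = refl
∑<-split (suc j) k g = trans (cong (g 0 +_) (∑<-split j k (g ∘ suc))) (sym (+-assoc (g 0) _ _))

∑<-vanishing : ∀ k j {g} → (∀ i → j ≤ i → g i ≡ 0) → ∑< k g ≤ ∑< j g
∑<-vanishing zero    j       g≡0 = z≤n
∑<-vanishing (suc k) zero    {g} g≡0 rewrite g≡0 0 z≤n = ∑<-vanishing k zero λ i _ → g≡0 (suc i) z≤n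
∑<-vanishing (suc k) (suc j) {g} g≡0 = +-monoʳ-≤ (g 0) (∑<-vanishing k j λ i j≤i → g≡0 (suc i) (s≤s j≤i))

∑<-last : ∀ k g → ∑< (suc k) g ≡ g k + ∑< k g
∑<-last zero    g = refl
∑<-last (suc k) g = trans (cong (g 0 +_) (∑<-last k (g ∘ suc))) (x∙yz≈y∙xz (g 0) (g (suc k)) _)

∑<-reverse : ∀ k g → ∑< k (λ i → g (k ∸ suc i)) ≡ ∑< k g
∑<-reverse zero    g = refl
∑<-reverse (suc k) g = trans (cong (g k +_) (∑<-reverse k g)) (sym (∑<-last k g))

𝟙 : Bool → ℕ
𝟙 true  = 1
𝟙 false = 0

∑<-initial : ∀ k t → ∑< k (λ i → 𝟙 (i <ᵇ t)) ≤ t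
∑<-initial zero    t       = z≤n
∑<-initial (suc k) zero    = ∑<-initial k zero
∑<-initial (suc k) (suc t) = s≤s (∑<-initial k t)

-- Matroid rank

∣∷∣ : ∀ b (A : Subset n) → ∣ b ∷ A ∣ ≡ 𝟙 b + ∣ A ∣
∣∷∣ true  A = refl
∣∷∣ false A = refl

∣∪∣+∣∩∣ : (A B : Subset n) → ∣ A ∪ B ∣ + ∣ A ∩ B ∣ ≡ ∣ A ∣ + ∣ B ∣
∣∪∣+∣∩∣ []          []          = refl
∣∪∣+∣∩∣ (true ∷ A)  (true ∷ B)  =
  cong suc (trans (+-suc _ _) (trans (cong suc (∣∪∣+∣∩∣ A B)) (sym (+-suc _ _))))
∣∪∣+∣∩∣ (true ∷ A)  (false ∷ B) = cong suc (∣∪∣+∣∩∣ A B)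
∣∪∣+∣∩∣ (false ∷ A) (true ∷ B)  = trans (cong suc (∣∪∣+∣∩∣ A B)) (sym (+-suc _ _))
∣∪∣+∣∩∣ (false ∷ A) (false ∷ B) = ∣∪∣+∣∩∣ A B

largest : {P : Subset n → Set} → Decidable P → P ⊥ →
          ∃[ A ] (P A × (∀ B → P B → ∣ B ∣ ≤ ∣ A ∣))
largest {n} {P} P? P⊥ = search n (λ B _ → ∣p∣≤n B)
  where
  search : ∀ k → (∀ B → P B → ∣ B ∣ ≤ k) → ∃[ A ] (P A × (∀ B → P B → ∣ B ∣ ≤ ∣ A ∣))
  search zero    ≤0 = ⊥ , P⊥ , λ B PB → ≤-trans (≤0 B PB) z≤n
  search (suc k) ≤1+k with anySubset? (λ A → P? A ×-dec (∣ A ∣ ≟ suc k))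
  ... | yes (A , PA , ∣A∣≡1+k) = A , PA , λ B PB → ≤-trans (≤1+k B PB) (≤-reflexive (sym ∣A∣≡1+k))
  ... | no ∄A = search k λ B PB → s≤s⁻¹ (≤∧≢⇒< (≤1+k B PB) λ ∣B∣≡1+k → ∄A (B , PB , ∣B∣≡1+k))

module _ (M : Matroid n) where

  -- Repeated exchange adds elements of `C` until the size of `C` is reached; the fuel `k` in `go`
  -- bounds how many are still missing.
  augment : ∀ {A C} → Indep M A → Indep M C →
            ∃[ B ] (Indep M B × A ⊆ B × B ⊆ A ∪ C × ∣ C ∣ ≤ ∣ B ∣)
  augment {A} {C} = go ∣ C ∣ (m≤n+m _ _)
    where
    go : ∀ k {A} → ∣ C ∣ ≤ ∣ A ∣ + k → Indep M A → Indep M C →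
         ∃[ B ] (Indep M B × A ⊆ B × B ⊆ A ∪ C × ∣ C ∣ ≤ ∣ B ∣)
    go k {A} ∣C∣≤ iA iC with ∣ C ∣ ≤? ∣ A ∣
    ... | yes ∣C∣≤∣A∣ = A , iA , id , p⊆p∪q C , ∣C∣≤∣A∣
    go zero    {A} ∣C∣≤ iA iC | no ∣C∣≰∣A∣ = contradiction (subst (_ ≤_) (+-identityʳ _) ∣C∣≤) ∣C∣≰∣A∣
    go (suc k) {A} ∣C∣≤ iA iC | no ∣C∣≰∣A∣
      with x , x∈C , x∉A , iA⁺ ← exchange M iA iC (≰⇒> ∣C∣≰∣A∣)
      with B , iB , A⁺⊆B , B⊆ , ∣C∣≤∣B∣ ← go k
             (≤-trans ∣C∣≤ (≤-trans (≤-reflexive (+-suc ∣ A ∣ k))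
               (+-monoˡ-≤ k (p⊂q⇒∣p∣<∣q∣ (q⊆p∪q ⁅ x ⁆ A , x , p⊆p∪q A (x∈⁅x⁆ x) , x∉A)))))
             iA⁺ iC
      = B , iB , A⁺⊆B ∘ q⊆p∪q ⁅ x ⁆ A , B⊆A∪C , ∣C∣≤∣B∣
      where
      B⊆A∪C : B ⊆ A ∪ C
      B⊆A∪C y∈B with x∈p∪q⁻ (⁅ x ⁆ ∪ A) C (B⊆ y∈B)
      ... | inj₂ y∈C = q⊆p∪q A C y∈C
      ... | inj₁ y∈A⁺ with x∈p∪q⁻ ⁅ x ⁆ A y∈A⁺
      ...   | inj₁ y∈⁅x⁆ rewrite x∈⁅y⁆⇒x≡y x y∈⁅x⁆ = q⊆p∪q A C x∈C
      ...   | inj₂ y∈A = p⊆p∪q C y∈A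

  module _ (indep? : Decidable (Indep M)) where

    -- Found by exhaustive search over all subsets, which is where the rank relies on decidable
    -- independence.
    basis : ∀ X → ∃[ A ] ((A ⊆ X × Indep M A) × (∀ B → B ⊆ X × Indep M B → ∣ B ∣ ≤ ∣ A ∣))
    basis X = largest (λ A → (A ⊆? X) ×-dec indep? A) (⊥⊆ , indep-empty M)

    rank : Subset n → ℕ
    rank X = ∣ proj₁ (basis X) ∣

    rank-lub : ∀ {X k} → (∀ {A} → A ⊆ X → Indep M A → ∣ A ∣ ≤ k) → rank X ≤ k
    rank-lub {X} bound with A , (A⊆X , iA) , _ ← basis X = bound A⊆X iA

    ∣∣≤rank : ∀ {A X} → A ⊆ X → Indep M A → ∣ A ∣ ≤ rank X
    ∣∣≤rank {A} {X} A⊆X iA = proj₂ (proj₂ (basis X)) A (A⊆X , iA)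

    rank-mono : ∀ {X Y} → X ⊆ Y → rank X ≤ rank Y
    rank-mono X⊆Y = rank-lub λ A⊆X → ∣∣≤rank (X⊆Y ∘ A⊆X)

    -- A largest independent `A` in `V` grows inside `A ∪ C` to an independent `B` no smaller than a
    -- largest independent `C` in `U`. Since `B` lies in `X ∪ Y` and `A` in both parts, counting
    -- `B ∩ X` and `B ∩ Y` gives the bound. Inclusions instead of equalities let level sets be
    -- plugged in directly.
    rank-submodular : ∀ {U V X Y} → U ⊆ X ∪ Y → V ⊆ X ∩ Y → rank U + rank V ≤ rank X + rank Y
    rank-submodular {U} {V} {X} {Y} U⊆ V⊆
      with C , (C⊆U , iC) , _ ← basis U
      with A , (A⊆V , iA) , _ ← basis V
      with B , iB , A⊆B , B⊆A∪C , ∣C∣≤∣B∣ ← augment iA iC = begin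
        ∣ C ∣ + ∣ A ∣                                       ≤⟨ +-mono-≤ (≤-trans ∣C∣≤∣B∣ (p⊆q⇒∣p∣≤∣q∣ B⊆)) (p⊆q⇒∣p∣≤∣q∣ A⊆) ⟩
        ∣ (B ∩ X) ∪ (B ∩ Y) ∣ + ∣ (B ∩ X) ∩ (B ∩ Y) ∣       ≡⟨ ∣∪∣+∣∩∣ (B ∩ X) (B ∩ Y) ⟩
        ∣ B ∩ X ∣ + ∣ B ∩ Y ∣                               ≤⟨ +-mono-≤ (bound X) (bound Y) ⟩
        rank X + rank Y                                     ∎
      where
      open ≤-Reasoning
      A⊆X∩Y : ∀ {x} → x ∈ A → x ∈ X × x ∈ Y
      A⊆X∩Y x∈A = x∈p∩q⁻ X Y (V⊆ (A⊆V x∈A))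
      B⊆ : B ⊆ (B ∩ X) ∪ (B ∩ Y)
      B⊆ x∈B with x∈p∪q⁻ A C (B⊆A∪C x∈B)
      ... | inj₁ x∈A = x∈p∪q⁺ (inj₁ (x∈p∩q⁺ (x∈B , proj₁ (A⊆X∩Y x∈A))))
      ... | inj₂ x∈C with x∈p∪q⁻ X Y (U⊆ (C⊆U x∈C))
      ...   | inj₁ x∈X = x∈p∪q⁺ (inj₁ (x∈p∩q⁺ (x∈B , x∈X)))
      ...   | inj₂ x∈Y = x∈p∪q⁺ (inj₂ (x∈p∩q⁺ (x∈B , x∈Y)))
      A⊆ : A ⊆ (B ∩ X) ∩ (B ∩ Y)
      A⊆ x∈A = x∈p∩q⁺ (x∈p∩q⁺ (A⊆B x∈A , proj₁ (A⊆X∩Y x∈A)) , x∈p∩q⁺ (A⊆B x∈A , proj₂ (A⊆X∩Y x∈A)))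
      bound : ∀ Z → ∣ B ∩ Z ∣ ≤ rank Z
      bound Z = ∣∣≤rank (p∩q⊆q B Z) (hereditary M (p∩q⊆p B Z) iB)

-- The Lovász extension of the rank function

level : (Fin n → ℕ) → ℕ → Subset n
level u i = tabulate (λ e → i <ᵇ u e)

∈-level⁻ : ∀ (u : Fin n → ℕ) {i e} → e ∈ level u i → i < u e
∈-level⁻ u {e = e} e∈ = <ᵇ⇒< _ _ (Equivalence.from T-≡ (trans (sym (lookup∘tabulate _ e)) ([]=⇒lookup e∈)))

∈-level⁺ : ∀ (u : Fin n → ℕ) {i e} → i < u e → e ∈ level u i
∈-level⁺ u {e = e} i<ue = lookup⇒[]= e _ (trans (lookup∘tabulate _ e) (Equivalence.to T-≡ (<⇒<ᵇ i<ue)))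

peak : (Fin n → ℕ) → ℕ
peak {zero}  u = 0
peak {suc n} u = u fzero ⊔ peak (u ∘ fsuc)

≤-peak : (u : Fin n → ℕ) → ∀ e → u e ≤ peak u
≤-peak u fzero    = m≤m⊔n _ _
≤-peak u (fsuc e) = ≤-trans (≤-peak (u ∘ fsuc) e) (m≤n⊔m (u fzero) _)

-- The two vectors of translation submodularity, that is, of L-natural convexity; for `α = 0` they
-- are join and meet.
upper lower : ℕ → (Fin n → ℕ) → (Fin n → ℕ) → Fin n → ℕ
upper α p q e = (p e ∸ α) ⊔ q e
lower α p q e = p e ⊓ (α + q e)

TranslationSubmodular : ((Fin n → ℕ) → ℕ) → Set
TranslationSubmodular f = ∀ α p q → f (upper α p q) + f (lower α p q) ≤ f p + f q

<⊔⇒ : ∀ {i} p q → i < p ⊔ q → i < p ⊎ i < q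
<⊔⇒ {i} p q i< with ⊔-sel p q
... | inj₁ eq = inj₁ (subst (i <_) eq i<)
... | inj₂ eq = inj₂ (subst (i <_) eq i<)

module _ (M : Matroid n) (indep? : Decidable (Indep M)) where

  private
    r = rank M indep?
    partial : ℕ → (Fin n → ℕ) → ℕ
    partial k u = ∑< k (λ i → r (level u i))

  lovász : (Fin n → ℕ) → ℕ
  lovász u = partial (peak u) u

  -- Levels from the peak on are empty and have rank zero. Hence sums of different lengths can be
  -- compared without tracking peaks.
  partial≤lovász : ∀ k u → ∑< k (λ i → rank M indep? (level u i)) ≤ lovász u
  partial≤lovász k u = ∑<-vanishing k (peak u) λ i peak≤i → n≤0⇒n≡0 (rank-lub M indep? λ {A} A⊆ _ →
    ≤-trans (p⊆q⇒∣p∣≤∣q∣ {q = ⊥} λ {x} x∈A → contradiction (≤-trans (≤-peak u x) peak≤i) (<⇒≱ (∈-level⁻ u (A⊆ x∈A))))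
            (≤-reflexive (∣⊥∣≡0 n)))

  -- The i-th level of the lower vector is that of p for i < α, and pairs up with
  -- the (i ∸ α)-th level of the upper vector otherwise.
  lovász-translation-submodular : TranslationSubmodular lovász
  lovász-translation-submodular α p q = begin
    lovász u + lovász v                                ≤⟨ +-mono-≤ (∑<-monoˡ _ (m≤m+n (peak u) (peak v))) (∑<-monoˡ _ (≤-trans (m≤n+m (peak v) (peak u)) (m≤n+m N α))) ⟩
    partial N u + partial (α + N) v                    ≡⟨ cong (partial N u +_) (∑<-split α N _) ⟩
    partial N u + (partial α v + shifted v)            ≡⟨ x∙yz≈y∙xz (partial N u) (partial α v) _ ⟩
    partial α v + (partial N u + shifted v)            ≡⟨ cong (partial α v +_) (sym (∑<-+ N _ _)) ⟩
    partial α v + ∑< N (λ i → r (level u i) + r (level v (α + i)))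
      ≤⟨ +-mono-≤ (∑<-mono α λ i _ → rank-mono M indep? (v⊆p i)) (∑<-mono N λ i _ → rank-submodular M indep? (u⊆ i) (v⊆ i)) ⟩
    partial α p + ∑< N (λ i → r (level p (α + i)) + r (level q i))
                                                       ≡⟨ cong (partial α p +_) (∑<-+ N _ _) ⟩
    partial α p + (shifted p + partial N q)            ≡⟨ sym (+-assoc (partial α p) _ _) ⟩
    partial α p + shifted p + partial N q              ≡⟨ cong (_+ partial N q) (sym (∑<-split α N _)) ⟩
    partial (α + N) p + partial N q                    ≤⟨ +-mono-≤ (partial≤lovász (α + N) p) (partial≤lovász N q) ⟩
    lovász p + lovász q                                ∎
    where
    open ≤-Reasoning
    u v : Fin n → ℕ
    u = upper α p q
    v = lower α p q
    N : ℕ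
    N = peak u + peak v
    shifted : (Fin n → ℕ) → ℕ
    shifted x = ∑< N (λ i → r (level x (α + i)))
    v⊆p : ∀ i → level v i ⊆ level p i
    v⊆p i {x} x∈ = ∈-level⁺ p (≤-trans (∈-level⁻ v x∈) (m⊓n≤m (p x) _))
    v⊆ : ∀ i → level v (α + i) ⊆ level p (α + i) ∩ level q i
    v⊆ i {x} x∈ = x∈p∩q⁺ (v⊆p (α + i) x∈ ,
      ∈-level⁺ q (+-cancelˡ-< α i (q x) (≤-trans (∈-level⁻ v x∈) (m⊓n≤n (p x) _))))
    u⊆ : ∀ i → level u i ⊆ level p (α + i) ∪ level q i
    u⊆ i {x} x∈ with <⊔⇒ (p x ∸ α) (q x) (∈-level⁻ u x∈)
    ... | inj₁ i<p∸α = x∈p∪q⁺ (inj₁ (∈-level⁺ p (subst (_< p x) (+-comm i α) (m<n∸o⇒m+o<n i<p∸α))))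
      where
      m<n∸o⇒m+o<n : ∀ {m n o} → m < n ∸ o → m + o < n
      m<n∸o⇒m+o<n {m} {n} {o} lt = m≤o∸n⇒m+n≤o (suc m) (<⇒≤ (m∸n≢0⇒n<m λ eq → contradiction (subst (m <_) eq lt) λ ())) lt
    ... | inj₂ i<q = x∈p∪q⁺ (inj₂ (∈-level⁺ q i<q))

-- Deletion and contraction of the first element

-- Deletion for `b = false`, contraction for `b = true`; the formula describes the contraction
-- because `i∅` then says that the first element is not a loop.
minor : ∀ b (M : Matroid (suc n)) → Indep M (b ∷ ⊥) → Matroid n
minor b M i∅ .Indep A = Indep M (b ∷ A)
minor b M i∅ .indep-empty = i∅
minor b M i∅ .hereditary A⊆B = hereditary M (s⊆s A⊆B)
minor b M i∅ .exchange {A} {B} iA iB ∣A∣<∣B∣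
  with exchange M iA iB (subst₂ _<_ (sym (∣∷∣ b A)) (sym (∣∷∣ b B)) (+-monoʳ-< (𝟙 b) ∣A∣<∣B∣))
... | fzero  , here    , x∉A , _  = contradiction here x∉A
... | fsuc x , there x∈B , x∉A , iA⁺ = x , x∈B , x∉A ∘ there , iA⁺

delete : Matroid (suc n) → Matroid n
delete M = minor false M (indep-empty M)

module _ (M : Matroid (suc n)) (indep? : Decidable (Indep M)) where

  -- No independent subset contains the first element if it is a loop or absent.
  rank-delete : ∀ b {X} → ¬ Indep M ⁅ fzero ⁆ ⊎ b ≡ false →
                rank M indep? (b ∷ X) ≤ rank (delete M) (indep? ∘ (false ∷_)) X
  rank-delete b {X} avoid = rank-lub M indep? bound
    where
    bound : ∀ {A} → A ⊆ b ∷ X → Indep M A → ∣ A ∣ ≤ rank (delete M) (indep? ∘ (false ∷_)) X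
    bound {true ∷ A}  A⊆ iA = contradiction (hereditary M (s⊆s ⊥⊆) iA)
      ([ id , (λ b≡false → contradiction (subst (λ b → fzero ∈ b ∷ _) b≡false (A⊆ here)) λ ()) ]′ avoid)
    bound {false ∷ A} A⊆ iA = ∣∣≤rank (delete M) (indep? ∘ (false ∷_)) (drop-∷-⊆ A⊆) iA

  lovász-delete : ∀ t u → ¬ Indep M ⁅ fzero ⁆ ⊎ t ≡ 0 →
                  lovász M indep? (t ◂ u) ≤ lovász (delete M) (indep? ∘ (false ∷_)) u
  lovász-delete t u avoid = ≤-trans
    (∑<-mono (peak (t ◂ u)) λ i _ → rank-delete (i <ᵇ t) ([ inj₁ , (λ t≡0 → inj₂ (cong (i <ᵇ_) t≡0)) ]′ avoid))
    (partial≤lovász (delete M) (indep? ∘ (false ∷_)) (peak (t ◂ u)) u)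

  module _ (i₀ : Indep M ⁅ fzero ⁆) where

    private
      M/0 = minor true M i₀

    -- `augment` trades an independent set for one that contains the first element and is no
    -- smaller; dropping that element leaves an independent set of the contraction.
    rank-contract : ∀ X → rank M indep? (true ∷ X) ≤ suc (rank M/0 (indep? ∘ (true ∷_)) X)
    rank-contract X = rank-lub M indep? λ {A} A⊆ iA → bound A⊆ (augment M i₀ iA)
      where
      bound : ∀ {A} → A ⊆ true ∷ X →
              ∃[ B ] (Indep M B × ⁅ fzero ⁆ ⊆ B × B ⊆ ⁅ fzero ⁆ ∪ A × ∣ A ∣ ≤ ∣ B ∣) →
              ∣ A ∣ ≤ suc (rank M/0 (indep? ∘ (true ∷_)) X)
      bound A⊆ (false ∷ B , _ , 0∈B , _) = contradiction (0∈B here) λ ()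
      bound {A} A⊆ (true ∷ B , iB , _ , B⊆ , ∣A∣≤∣B∣) =
        ≤-trans ∣A∣≤∣B∣ (s≤s (∣∣≤rank M/0 (indep? ∘ (true ∷_)) B⊆X iB))
        where
        B⊆X : B ⊆ X
        B⊆X {x} x∈B with x∈p∪q⁻ ⁅ fzero ⁆ A (B⊆ (there x∈B))
        ... | inj₁ x∈⁅0⁆ = contradiction (drop-there x∈⁅0⁆) ∉⊥
        ... | inj₂ x∈A   = drop-there (A⊆ x∈A)

    -- Each level below `t` contains the first element and costs one extra unit by `rank-contract`;
    -- as `peak u ≤ t`, the levels from `t` on are empty.
    lovász-contract : ∀ t u → peak u ≤ t →
                      lovász M indep? (t ◂ u) ≤ t + lovász M/0 (indep? ∘ (true ∷_)) u
    lovász-contract t u peak≤t = begin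
      lovász M indep? (t ◂ u)                                  ≤⟨ ∑<-mono k (λ i _ → rank-level i) ⟩
      ∑< k (λ i → 𝟙 (i <ᵇ t) + r/0 (level u i))                ≡⟨ ∑<-+ k _ _ ⟩
      ∑< k (λ i → 𝟙 (i <ᵇ t)) + ∑< k (λ i → r/0 (level u i))   ≤⟨ +-mono-≤ (∑<-initial k t) (partial≤lovász M/0 (indep? ∘ (true ∷_)) k u) ⟩
      t + lovász M/0 (indep? ∘ (true ∷_)) u                    ∎
      where
      open ≤-Reasoning
      k = peak (t ◂ u)
      r/0 = rank M/0 (indep? ∘ (true ∷_))
      rank-level : ∀ i → rank M indep? (level (t ◂ u) i) ≤ 𝟙 (i <ᵇ t) + r/0 (level u i)
      rank-level i with i <ᵇ t in i<ᵇt
      ... | true  = rank-contract (level u i)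
      ... | false = rank-lub M indep? λ A⊆ _ →
        ≤-trans (p⊆q⇒∣p∣≤∣q∣ {q = ⊥} (empty ∘ A⊆)) (≤-trans (≤-reflexive (∣⊥∣≡0 n)) z≤n)
        where
        t≤i : t ≤ i
        t≤i = ≮⇒≥ λ i<t → contradiction (trans (sym i<ᵇt) (Equivalence.to T-≡ (<⇒<ᵇ i<t))) λ ()
        empty : false ∷ level u i ⊆ ⊥
        empty {fsuc x} (there x∈) =
          contradiction (≤-trans (≤-peak u x) (≤-trans peak≤t t≤i)) (<⇒≱ (∈-level⁻ u x∈))

-- Uncrossing

-- If the minimum is `b₂`, the second cover suffices. Otherwise what `a₁` loses, at most `α`, is
-- returned in `α + a₂`.
upper+lower-covers : ∀ α {w a₁ a₂ b₁ b₂} → w ≤ a₁ + a₂ → w ≤ b₁ + b₂ →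
                     w ≤ ((a₁ ∸ α) ⊔ b₁) + (b₂ ⊓ (α + a₂))
upper+lower-covers α {w} {a₁} {a₂} {b₁} {b₂} w≤a w≤b with ⊓-sel b₂ (α + a₂)
... | inj₁ eq rewrite eq = ≤-trans w≤b (+-monoˡ-≤ b₂ (m≤n⊔m (a₁ ∸ α) b₁))
... | inj₂ eq rewrite eq = begin
  w                              ≤⟨ w≤a ⟩
  a₁ + a₂                        ≤⟨ +-monoˡ-≤ a₂ (m≤n+m∸n a₁ α) ⟩
  α + (a₁ ∸ α) + a₂              ≡⟨ cong (_+ a₂) (+-comm α _) ⟩
  a₁ ∸ α + α + a₂                ≡⟨ +-assoc (a₁ ∸ α) α a₂ ⟩
  a₁ ∸ α + (α + a₂)              ≤⟨ +-monoˡ-≤ (α + a₂) (m≤m⊔n (a₁ ∸ α) b₁) ⟩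
  (a₁ ∸ α) ⊔ b₁ + (α + a₂)       ∎
  where open ≤-Reasoning

-- The pair is `q` and `p` when `p ≤ α + q`, and `p ∸ α` and `α + q` otherwise. This exactness keeps
-- the total height constant.
upper+lower : ∀ α p q → ((p ∸ α) ⊔ q) + (p ⊓ (α + q)) ≡ p + q
upper+lower α p q with ≤-total p (α + q)
... | inj₁ p≤ rewrite m≤n⇒m⊔n≡n (m≤n+o⇒m∸n≤o p α p≤) | m≤n⇒m⊓n≡m p≤ = +-comm q p
... | inj₂ ≤p rewrite m≥n⇒m⊓n≡n ≤p
                    | m≥n⇒m⊔n≡m (subst (_≤ p ∸ α) (m+n∸m≡n α q) (∸-monoˡ-≤ α ≤p)) =
  trans (sym (+-assoc (p ∸ α) α q)) (cong (_+ q) (m∸n+n≡m (≤-trans (m≤m+n α q) ≤p)))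

module Uncrossing (f₁ f₂ : (Fin (suc n) → ℕ) → ℕ)
  (sub₁ : TranslationSubmodular f₁) (sub₂ : TranslationSubmodular f₂)
  (w : Fin n → ℕ) where

  -- The first coordinate is left free.
  record Cover : Set where
    constructor mkCover
    field
      u₁ u₂  : Fin (suc n) → ℕ
      covers : ∀ e → w e ≤ u₁ (fsuc e) + u₂ (fsuc e)
    value height : ℕ
    value  = f₁ u₁ + f₂ u₂
    height = u₁ fzero + u₂ fzero
  open Cover

  -- The second vectors enter in the opposite order, so that what one side loses by the shift `α`
  -- the other side gains; this preserves covering.
  cross₁ cross₂ : ℕ → Cover → Cover → Cover
  cross₁ α a b = mkCover (upper α (u₁ a) (u₁ b)) (lower α (u₂ b) (u₂ a))
    λ e → upper+lower-covers α (covers a e) (covers b e)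
  cross₂ α a b = mkCover (lower α (u₁ a) (u₁ b)) (upper α (u₂ b) (u₂ a))
    λ e → subst (w e ≤_) (+-comm (upper α (u₂ b) (u₂ a) (fsuc e)) _)
      (upper+lower-covers α (subst (w e ≤_) (+-comm (u₁ b (fsuc e)) _) (covers b e))
                            (subst (w e ≤_) (+-comm (u₁ a (fsuc e)) _) (covers a e)))

  value-cross : ∀ α a b → value (cross₁ α a b) + value (cross₂ α a b) ≤ value a + value b
  value-cross α a b = begin
    value (cross₁ α a b) + value (cross₂ α a b)
      ≡⟨ interchange (f₁ (upper α (u₁ a) (u₁ b))) _ _ _ ⟩
    (f₁ (upper α (u₁ a) (u₁ b)) + f₁ (lower α (u₁ a) (u₁ b))) + (f₂ (lower α (u₂ b) (u₂ a)) + f₂ (upper α (u₂ b) (u₂ a)))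
      ≤⟨ +-mono-≤ (sub₁ α (u₁ a) (u₁ b)) (≤-trans (≤-reflexive (+-comm (f₂ (lower α (u₂ b) (u₂ a))) _)) (sub₂ α (u₂ b) (u₂ a))) ⟩
    (f₁ (u₁ a) + f₁ (u₁ b)) + (f₂ (u₂ b) + f₂ (u₂ a))
      ≡⟨ cong (f₁ (u₁ a) + f₁ (u₁ b) +_) (+-comm (f₂ (u₂ b)) _) ⟩
    (f₁ (u₁ a) + f₁ (u₁ b)) + (f₂ (u₂ a) + f₂ (u₂ b))
      ≡⟨ interchange (f₁ (u₁ a)) _ _ _ ⟩
    value a + value b ∎
    where open ≤-Reasoning

  height-cross : ∀ α a b → height (cross₁ α a b) + height (cross₂ α a b) ≡ height a + height b
  height-cross α a b = trans (interchange (upper α (u₁ a) (u₁ b) fzero) _ _ _)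
    (trans (cong₂ _+_ (upper+lower α (u₁ a fzero) (u₁ b fzero))
                      (trans (+-comm (lower α (u₂ b) (u₂ a) fzero) _) (trans (upper+lower α (u₂ b fzero) (u₂ a fzero)) (+-comm (u₂ b fzero) _))))
           (interchange (u₁ a fzero) _ _ _))

  -- The shift is chosen to give one crossed cover height exactly `height a + 1`; `height-cross`
  -- then fixes the other.
  approach : ∀ a b → 2 + height a ≤ height b →
             ∃[ c ] ∃[ d ] (height c ≡ suc (height a) × suc (height d) ≡ height b ×
                            value c + value d ≤ value a + value b)
  approach a b 2+a≤b with u₁ b fzero ≤? suc (u₁ a fzero)
  ... | yes b₁≤1+a₁ = cross₁ α a b , cross₂ α a b , hc , hd , value-cross α a b
    where
    a₁ = u₁ a fzero
    a₂ = u₂ a fzero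
    b₁ = u₁ b fzero
    -- With this shift the maximum is `b₁` and the minimum is `α + a₂`, which add up to
    -- `1 + a₁ + a₂`.
    α = suc a₁ ∸ b₁
    α+b₁ : α + b₁ ≡ suc a₁
    α+b₁ = m∸n+n≡m b₁≤1+a₁
    b₁+α+a₂ : b₁ + (α + a₂) ≡ suc (a₁ + a₂)
    b₁+α+a₂ = trans (sym (+-assoc b₁ α a₂)) (cong (_+ a₂) (trans (+-comm b₁ α) α+b₁))
    hc : height (cross₁ α a b) ≡ suc (height a)
    hc = trans (cong₂ _+_
           (m≤n⇒m⊔n≡n (m≤n+o⇒m∸n≤o a₁ α (subst (a₁ ≤_) (sym α+b₁) (n≤1+n a₁))))
           (m≥n⇒m⊓n≡n (+-cancelˡ-≤ b₁ _ _ (≤-trans (≤-reflexive b₁+α+a₂) (<⇒≤ 2+a≤b)))))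
         b₁+α+a₂
    hd : suc (height (cross₂ α a b)) ≡ height b
    hd = +-cancelˡ-≡ (height a) _ _ (trans (+-suc (height a) _)
           (trans (cong (_+ height (cross₂ α a b)) (sym hc)) (height-cross α a b)))
  ... | no b₁≰1+a₁ = cross₁ β b a , cross₂ β b a , hc , hd ,
                     ≤-trans (value-cross β b a) (≤-reflexive (+-comm (value b) _))
    where
    a₁ = u₁ a fzero
    a₂ = u₂ a fzero
    b₁ = u₁ b fzero
    b₂ = u₂ b fzero
    -- The roles of `a` and `b` are swapped here: `b₁ ∸ β = 1 + a₁` is the maximum and `a₂` the
    -- minimum.
    β = b₁ ∸ suc a₁
    1+a₁≤b₁ : suc a₁ ≤ b₁
    1+a₁≤b₁ = <⇒≤ (≰⇒> b₁≰1+a₁)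
    a₂≤β+b₂ : a₂ ≤ β + b₂
    a₂≤β+b₂ = +-cancelˡ-≤ (suc a₁) _ _ (≤-trans (<⇒≤ 2+a≤b)
      (≤-reflexive (trans (cong (_+ b₂) (sym (m+[n∸m]≡n 1+a₁≤b₁))) (+-assoc (suc a₁) β b₂))))
    hc : height (cross₁ β b a) ≡ suc (height a)
    hc = cong₂ _+_
      (trans (cong (_⊔ a₁) (m∸[m∸n]≡n 1+a₁≤b₁)) (m≥n⇒m⊔n≡m (n≤1+n a₁)))
      (m≤n⇒m⊓n≡m a₂≤β+b₂)
    hd : suc (height (cross₂ β b a)) ≡ height b
    hd = +-cancelˡ-≡ (height a) _ _ (trans (+-suc (height a) _)
           (trans (cong (_+ height (cross₂ β b a)) (sym hc)) (trans (height-cross β b a) (+-comm (height b) _))))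

  -- Each step raises a or lowers b by one unit of height: integrality of the
  -- values forces one of the two uncrossed covers to keep its bound.
  sweep : ∀ {x y t} k a b → height b ≡ k + height a → height a ≤ t → t ≤ height b →
          value a ≤ x → value b ≤ y + height b →
          ∃[ c ] (t ≤ height c × (value c ≤ x ⊎ value c ≤ y + t))
  sweep zero a b hb a≤t t≤b va vb = a , ≤-trans t≤b (≤-reflexive hb) , inj₁ va
  sweep {x} {y} {t} (suc k) a b hb a≤t t≤b va vb with height a ≟ t | height b ≟ t
  ... | yes a≡t | _       = a , ≤-reflexive (sym a≡t) , inj₁ va
  ... | no _    | yes b≡t = b , t≤b , inj₂ (subst (λ h → value b ≤ y + h) b≡t vb)
  ... | no a≢t  | no b≢t
    with c , d , hc , hd , vcd ← approach a b (≤-trans (s≤s (≤∧≢⇒< a≤t a≢t)) (≤∧≢⇒< t≤b (b≢t ∘ sym)))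
    with value c ≤? x
  ... | yes vc = sweep k c b (trans hb (trans (sym (+-suc k _)) (cong (k +_) (sym hc))))
                   (≤-trans (≤-reflexive hc) (≤∧≢⇒< a≤t a≢t)) t≤b vc vb
  ... | no vc≰x = sweep k a d (suc-injective (trans hd hb)) a≤t
                    (s≤s⁻¹ (≤-trans (≤∧≢⇒< t≤b (b≢t ∘ sym)) (≤-reflexive (sym hd)))) va vd
    where
    open ≤-Reasoning
    -- The value of `c` is at least `x + 1`, and this surplus pays for the unit of height lost from
    -- `b` to `d`.
    vd : value d ≤ y + height d
    vd = +-cancelˡ-≤ (suc x) _ _ (begin
      suc x + value d              ≤⟨ +-monoˡ-≤ (value d) (≰⇒> vc≰x) ⟩
      value c + value d            ≤⟨ vcd ⟩
      value a + value b            ≤⟨ +-mono-≤ va vb ⟩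
      x + (y + height b)           ≡⟨ cong (λ h → x + (y + h)) (sym hd) ⟩
      x + (y + suc (height d))     ≡⟨ cong (x +_) (+-suc y _) ⟩
      x + suc (y + height d)       ≡⟨ +-suc x _ ⟩
      suc x + (y + height d)       ∎)

-- Weight splitting

weight-splitting : ∀ {n} (M₁ M₂ : Matroid n)
  (indep₁? : Decidable (Indep M₁)) (indep₂? : Decidable (Indep M₂)) (w : Fin n → ℕ) →
  ∃[ S ] ∃[ u₁ ] ∃[ u₂ ] (CommonIndep M₁ M₂ S × (∀ e → w e ≤ u₁ e + u₂ e) ×
                          lovász M₁ indep₁? u₁ + lovász M₂ indep₂? u₂ ≤ weight w S)
weight-splitting {zero} M₁ M₂ _ _ w = [] , w , w , (indep-empty M₁ , indep-empty M₂) , (λ ()) , z≤n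
weight-splitting {suc n} M₁ M₂ d₁ d₂ w
  with S , a₁ , a₂ , iS , a-covers , a≤S ←
    weight-splitting (delete M₁) (delete M₂) (d₁ ∘ (false ∷_)) (d₂ ∘ (false ∷_)) (w ∘ fsuc)
  with d₁ ⁅ fzero ⁆ | d₂ ⁅ fzero ⁆
-- The whole weight of a loop goes to the side where it is a loop, since it adds nothing to the rank
-- there.
... | no loop₁ | _ = false ∷ S , w fzero ◂ a₁ , 0 ◂ a₂ , iS ,
  (λ { fzero → m≤m+n _ 0 ; (fsuc e) → a-covers e }) ,
  ≤-trans (+-mono-≤ (lovász-delete M₁ d₁ (w fzero) a₁ (inj₁ loop₁)) (lovász-delete M₂ d₂ 0 a₂ (inj₂ refl))) a≤S
... | yes _ | no loop₂ = false ∷ S , 0 ◂ a₁ , w fzero ◂ a₂ , iS ,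
  (λ { fzero → ≤-refl ; (fsuc e) → a-covers e }) ,
  ≤-trans (+-mono-≤ (lovász-delete M₁ d₁ 0 a₁ (inj₂ refl)) (lovász-delete M₂ d₂ (w fzero) a₂ (inj₁ loop₂))) a≤S
... | yes i₁ | yes i₂
  with R , b₁ , b₂ , iR , b-covers , b≤R ←
    weight-splitting (minor true M₁ i₁) (minor true M₂ i₂) (d₁ ∘ (true ∷_)) (d₂ ∘ (true ∷_)) (w ∘ fsuc)
  = split (sweep (t + t) a b (sym (+-identityʳ (t + t))) z≤n (≤-trans (m≤m+n _ _) (m≤m+n t t)) va vb)
  where
  open Uncrossing (lovász M₁ d₁) (lovász M₂ d₂)
    (lovász-translation-submodular M₁ d₁) (lovász-translation-submodular M₂ d₂) (w ∘ fsuc)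
  open Cover
  open ≤-Reasoning
  t : ℕ
  -- Above both peaks, as `lovász-contract` requires, and at least `w fzero`, so that the target
  -- height lies between those of `a` and `b`.
  t = w fzero + (peak b₁ + peak b₂)
  a b : Cover
  a = mkCover (0 ◂ a₁) (0 ◂ a₂) a-covers
  b = mkCover (t ◂ b₁) (t ◂ b₂) b-covers
  va : value a ≤ weight (w ∘ fsuc) S
  va = ≤-trans (+-mono-≤ (lovász-delete M₁ d₁ 0 a₁ (inj₂ refl)) (lovász-delete M₂ d₂ 0 a₂ (inj₂ refl))) a≤S
  vb : value b ≤ weight (w ∘ fsuc) R + height b
  vb = begin
    value b                                  ≤⟨ +-mono-≤ (lovász-contract M₁ d₁ i₁ t b₁ (≤-trans (m≤m+n _ _) (m≤n+m _ (w fzero))))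
                                                         (lovász-contract M₂ d₂ i₂ t b₂ (≤-trans (m≤n+m _ (peak b₁)) (m≤n+m _ (w fzero)))) ⟩
    (t + _) + (t + _)                        ≡⟨ interchange t _ t _ ⟩
    (t + t) + _                              ≤⟨ +-monoʳ-≤ (t + t) b≤R ⟩
    (t + t) + weight (w ∘ fsuc) R            ≡⟨ +-comm (t + t) _ ⟩
    weight (w ∘ fsuc) R + (t + t)            ∎
  split : ∃[ c ] (w fzero ≤ height c × (value c ≤ weight (w ∘ fsuc) S ⊎ value c ≤ weight (w ∘ fsuc) R + w fzero)) →
          ∃[ S ] ∃[ u₁ ] ∃[ u₂ ] (CommonIndep M₁ M₂ S × (∀ e → w e ≤ u₁ e + u₂ e) ×
                                  lovász M₁ d₁ u₁ + lovász M₂ d₂ u₂ ≤ weight w S)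
  split (c , w≤c , v) = [ (λ v≤S → false ∷ S , u₁ c , u₂ c , iS , c-covers , v≤S)
                        , (λ v≤R → true ∷ R , u₁ c , u₂ c , iR , c-covers , ≤-trans v≤R (≤-reflexive (+-comm _ (w fzero)))) ]′ v
    where
    c-covers : ∀ e → w e ≤ u₁ c e + u₂ c e
    c-covers fzero    = w≤c
    c-covers (fsuc e) = covers c e

-- Unfolded sets

∣∣≡∑bit : (v : Subset m) → ∣ v ∣ ≡ ∑< m (𝟙 ∘ bit v)
∣∣≡∑bit []      = refl
∣∣≡∑bit (b ∷ v) = trans (∣∷∣ b v) (cong (𝟙 b +_) (∣∣≡∑bit v))

bitᵒᵖ : Subset m → ℕ → Bool
bitᵒᵖ {m} v i = if i <ᵇ m then bit v (m ∸ suc i) else false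

<⇒<ᵇ≡true : ∀ {i k} → i < k → (i <ᵇ k) ≡ true
<⇒<ᵇ≡true i<k = Equivalence.to T-≡ (<⇒<ᵇ i<k)

-- Copy j is charged to the first sum if j < a, and otherwise to the second one,
-- where its index m ∸ suc j is less than b.
∣∣≤split-copies : ∀ W a b (v : Subset m) → m ≤ W → m ≤ a + b →
  ∣ v ∣ ≤ ∑< W (λ i → 𝟙 (bit v i ∧ (i <ᵇ a))) + ∑< W (λ i → 𝟙 (bitᵒᵖ v i ∧ (i <ᵇ b)))
∣∣≤split-copies {m} W a b v m≤W m≤a+b = begin
  ∣ v ∣                              ≡⟨ ∣∣≡∑bit v ⟩
  ∑< m (𝟙 ∘ bit v)                   ≤⟨ ∑<-mono m charge ⟩
  ∑< m (λ j → G j + H j)             ≡⟨ ∑<-+ m G H ⟩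
  -- Reversal passes from the index of a copy to its position counted from the end, which is how
  -- `bitᵒᵖ` reads it.
  ∑< m G + ∑< m H                    ≡⟨ cong (∑< m G +_) (sym (∑<-reverse m H)) ⟩
  ∑< m G + ∑< m (λ i → H (m ∸ suc i)) ≤⟨ +-monoʳ-≤ (∑< m G) (∑<-mono m reflect) ⟩
  ∑< m G + ∑< m H′                   ≤⟨ +-mono-≤ (∑<-monoˡ G m≤W) (∑<-monoˡ H′ m≤W) ⟩
  ∑< W G + ∑< W H′                   ∎
  where
  open ≤-Reasoning
  G H H′ : ℕ → ℕ
  G i = 𝟙 (bit v i ∧ (i <ᵇ a))
  H j = 𝟙 (bit v j ∧ (m ∸ suc j <ᵇ b))
  H′ i = 𝟙 (bitᵒᵖ v i ∧ (i <ᵇ b))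
  late : ∀ {j} → j < m → a ≤ j → m ∸ suc j < b
  late {j} j<m a≤j = +-cancelˡ-≤ j _ _ (begin
    j + suc (m ∸ suc j)    ≡⟨ trans (+-suc j _) (m+[n∸m]≡n j<m) ⟩
    m                      ≤⟨ m≤a+b ⟩
    a + b                  ≤⟨ +-monoˡ-≤ b a≤j ⟩
    j + b                  ∎)
  charge : ∀ j → j < m → 𝟙 (bit v j) ≤ G j + H j
  charge j j<m with bit v j
  ... | false = z≤n
  ... | true with j <? a
  ...   | yes j<a rewrite <⇒<ᵇ≡true j<a = s≤s z≤n
  ...   | no j≮a rewrite <⇒<ᵇ≡true (late j<m (≮⇒≥ j≮a)) = m≤n+m 1 _
  m∸1+[m∸1+i] : ∀ {i m} → i < m → m ∸ suc (m ∸ suc i) ≡ i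
  m∸1+[m∸1+i] {i} {suc m} (s≤s i≤m) = m∸[m∸n]≡n i≤m
  reflect : ∀ i → i < m → H (m ∸ suc i) ≤ H′ i
  reflect i i<m rewrite <⇒<ᵇ≡true i<m | m∸1+[m∸1+i] i<m = ≤-refl

-- At `toℕ i` these are definitionally `proj₁I` and `proj₂I`; natural indices fit the sums over
-- levels.
slice₁ slice₂ : {w : Fin n → ℕ} → UnfSubset w → ℕ → Subset n
slice₁ I i = tabulate (λ e → bit (I e) i)
slice₂ I i = tabulate (λ e → bitᵒᵖ (I e) i)

-- The charges of `∣∣≤split-copies` are regrouped by slice; `w e ≤ W` leaves no copy beyond the
-- summed slices.
card≤∑slices : ∀ {n} W {w : Fin n → ℕ} (I : UnfSubset w) u₁ u₂ →
  (∀ e → w e ≤ W) → (∀ e → w e ≤ u₁ e + u₂ e) →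
  card I ≤ ∑< W (λ i → ∣ slice₁ I i ∩ level u₁ i ∣) + ∑< W (λ i → ∣ slice₂ I i ∩ level u₂ i ∣)
card≤∑slices {zero}  W I u₁ u₂ w≤W w≤u = z≤n
card≤∑slices {suc n} W I u₁ u₂ w≤W w≤u = begin
  ∣ I fzero ∣ + card (λ e → I (fsuc e))
    ≤⟨ +-mono-≤ (∣∣≤split-copies W (u₁ fzero) (u₂ fzero) (I fzero) (w≤W fzero) (w≤u fzero))
                (card≤∑slices W (I ∘ fsuc) (u₁ ∘ fsuc) (u₂ ∘ fsuc) (w≤W ∘ fsuc) (w≤u ∘ fsuc)) ⟩
  (∑< W g₁ + ∑< W g₂) + (∑< W h₁ + ∑< W h₂)           ≡⟨ interchange (∑< W g₁) _ _ _ ⟩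
  (∑< W g₁ + ∑< W h₁) + (∑< W g₂ + ∑< W h₂)           ≡⟨ cong₂ _+_ (sym (∑<-+ W g₁ h₁)) (sym (∑<-+ W g₂ h₂)) ⟩
  ∑< W (λ i → g₁ i + h₁ i) + ∑< W (λ i → g₂ i + h₂ i)
    ≤⟨ +-mono-≤
         (∑<-mono W λ i _ → ≤-reflexive (sym (∣∷∣ (bit (I fzero) i ∧ (i <ᵇ u₁ fzero)) (slice₁ (I ∘ fsuc) i ∩ level (u₁ ∘ fsuc) i))))
         (∑<-mono W λ i _ → ≤-reflexive (sym (∣∷∣ (bitᵒᵖ (I fzero) i ∧ (i <ᵇ u₂ fzero)) (slice₂ (I ∘ fsuc) i ∩ level (u₂ ∘ fsuc) i)))) ⟩
  ∑< W (λ i → ∣ slice₁ I i ∩ level u₁ i ∣) + ∑< W (λ i → ∣ slice₂ I i ∩ level u₂ i ∣) ∎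
  where
  open ≤-Reasoning
  g₁ g₂ h₁ h₂ : ℕ → ℕ
  g₁ i = 𝟙 (bit (I fzero) i ∧ (i <ᵇ u₁ fzero))
  g₂ i = 𝟙 (bitᵒᵖ (I fzero) i ∧ (i <ᵇ u₂ fzero))
  h₁ i = ∣ slice₁ (I ∘ fsuc) i ∩ level (u₁ ∘ fsuc) i ∣
  h₂ i = ∣ slice₂ (I ∘ fsuc) i ∩ level (u₂ ∘ fsuc) i ∣

-- A slice cut down to a level is an independent subset of that level, hence bounded by its rank.
∑slices≤lovász : ∀ W (M : Matroid n) (indep? : Decidable (Indep M)) (slice : ℕ → Subset n) u →
  ((i : Fin W) → Indep M (slice (toℕ i))) →
  ∑< W (λ i → ∣ slice i ∩ level u i ∣) ≤ lovász M indep? u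
∑slices≤lovász W M indep? slice u iSlice = ≤-trans
  (∑<-mono W λ i i<W → ∣∣≤rank M indep? (p∩q⊆q (slice i) _)
    (hereditary M (p∩q⊆p (slice i) _) (subst (Indep M ∘ slice) (toℕ-fromℕ< i<W) (iSlice (fromℕ< i<W)))))
  (partial≤lovász M indep? W u)

-- The unfolding of a common independent set

copies : Bool → ∀ m → Subset m
copies b m = if b then ⊤ else ⊥

unfold : (w : Fin n → ℕ) → Subset n → UnfSubset w
unfold w S e = copies (lookup S e) (w e)

card-unfold : (w : Fin n → ℕ) (S : Subset n) → card (unfold w S) ≡ weight w S
card-unfold w []          = refl
card-unfold w (true ∷ S)  = cong₂ _+_ (∣⊤∣≡n (w fzero)) (card-unfold (w ∘ fsuc) S)
card-unfold w (false ∷ S) = cong₂ _+_ (∣⊥∣≡0 (w fzero)) (card-unfold (w ∘ fsuc) S)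

bit-⊥ : ∀ m k → bit (⊥ {m}) k ≡ false
bit-⊥ zero    k       = refl
bit-⊥ (suc m) zero    = refl
bit-⊥ (suc m) (suc k) = bit-⊥ m k

-- The converse fails for indices beyond `m`, which read `false`; this direction suffices because
-- independence is hereditary.
bit-copies : ∀ b m k → bit (copies b m) k ≡ true → b ≡ true
bit-copies true  m k _  = refl
bit-copies false m k eq = trans (sym (bit-⊥ m k)) eq

bitᵒᵖ-copies : ∀ b m k → bitᵒᵖ (copies b m) k ≡ true → b ≡ true
bitᵒᵖ-copies b m k eq with k <ᵇ m
... | true = bit-copies b m (m ∸ suc k) eq

tabulate-⊆ : ∀ {g : Fin n → Bool} {S} → (∀ e → g e ≡ true → lookup S e ≡ true) → tabulate g ⊆ S
tabulate-⊆ {g = g} {S} g⇒S {e} e∈ = lookup⇒[]= e S (g⇒S e (trans (sym (lookup∘tabulate g e)) ([]=⇒lookup e∈)))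

-- Double negation shifts past a quantifier over finitely many subsets; this gives decidable
-- independence under a double negation.
¬¬-choice : ∀ {n} {P : Subset n → Set} → (∀ A → ¬ ¬ P A) → ¬ ¬ (∀ A → P A)
¬¬-choice {zero}  ¬¬P ¬∀P = ¬¬P [] λ P[] → ¬∀P λ { [] → P[] }
¬¬-choice {suc n} ¬¬P ¬∀P =
  ¬¬-choice (¬¬P ∘ (true ∷_)) λ Pt →
  ¬¬-choice (¬¬P ∘ (false ∷_)) λ Pf →
  ¬∀P λ { (true ∷ A) → Pt A ; (false ∷ A) → Pf A }

theorem1 : (n W : ℕ) (M₁' M₂' : Matroid n) (w : Fin n → ℕ) →
    (∀ e → 1 ≤ w e) → (∀ e → w e ≤ W) →
    (OPT' OPT : ℕ) →
    IsMaxCommonWeight M₁' M₂' w OPT' →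
    IsMaxUnfoldedCard W M₁' M₂' w OPT →
    OPT ≡ OPT'
theorem1 n W M₁ M₂ w _ w≤W OPT' OPT ((S , (iS₁ , iS₂) , S≡OPT') , ≤OPT') ((I , (iI₁ , iI₂) , I≡OPT) , ≤OPT) =
  ≤-antisym OPT≤OPT' OPT'≤OPT
  where
  open ≤-Reasoning
  OPT'≤OPT : OPT' ≤ OPT
  OPT'≤OPT = begin
    OPT'                ≡⟨ sym S≡OPT' ⟩
    weight w S          ≡⟨ sym (card-unfold w S) ⟩
    -- Every slice of the unfolding is contained in `S`, so it inherits independence.
    card (unfold w S)   ≤⟨ ≤OPT (unfold w S)
                             (λ i → hereditary M₁ (tabulate-⊆ λ e → bit-copies (lookup S e) (w e) (toℕ i)) iS₁)
                             (λ i → hereditary M₂ (tabulate-⊆ λ e → bitᵒᵖ-copies (lookup S e) (w e) (toℕ i)) iS₂) ⟩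
    OPT                 ∎

  bounded : Decidable (Indep M₁) → Decidable (Indep M₂) → OPT ≤ OPT'
  bounded d₁ d₂ with R , u₁ , u₂ , iR , w≤u , u≤R ← weight-splitting M₁ M₂ d₁ d₂ w = begin
    OPT                              ≡⟨ sym I≡OPT ⟩
    card I                           ≤⟨ card≤∑slices W I u₁ u₂ w≤W w≤u ⟩
    _                                ≤⟨ +-mono-≤ (∑slices≤lovász W M₁ d₁ (slice₁ I) u₁ iI₁)
                                                 (∑slices≤lovász W M₂ d₂ (slice₂ I) u₂ iI₂) ⟩
    lovász M₁ d₁ u₁ + lovász M₂ d₂ u₂ ≤⟨ u≤R ⟩
    weight w R                       ≤⟨ ≤OPT' R iR ⟩
    OPT'                             ∎

  -- Independence need not be decidable, but the inequality is a stable proposition.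
  OPT≤OPT' : OPT ≤ OPT'
  OPT≤OPT' = decidable-stable (OPT ≤? OPT') λ OPT≰OPT' →
    ¬¬-choice (λ _ → ¬¬-excluded-middle) λ d₁ →
    ¬¬-choice (λ _ → ¬¬-excluded-middle) λ d₂ → OPT≰OPT' (bounded d₁ d₂)
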